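{- Let $1\le i_1<i_2<\dots<i_k<n$, and let $m=i_1+\dots+i_k$. There is a bijection $$\{\pi\in\mathcal I_n(321):\mathrm{Des}(\pi)=\{i_1,i_2,...,i_k\}\}\longrightarrow \{\lambda\vdash m:\mathrm{hd}(\lambda)=\{i_1,i_2,\dots,i_k\},\lambda\subseteq B_n\}.$$
   Context: $\mathcal I_n(321)$ is the set of $321$-avoiding involutions of $\{1,\dots,n\}$; $\mathrm{Des}(\pi)$ is the set of descent positions $i$ with $\pi(i)>\pi(i+1)$. $B_n$ is the $\lfloor n/2\rfloor\times\lceil n/2\rceil$ box, and $\lambda\subseteq B_n$ means the Young diagram of $\lambda$ fits inside it (at most $\lfloor n/2\rfloor$ parts, each at most $\lceil n/2\rceil$). The hook decomposition $\mathrm{hd}(\lambda)=\{i_1<\dots<i_k\}$ is defined as follows: $k$ is the side of the Durfee square of $\lambda$; $i_k$ is the number of boxes in the largest hook (first row together with first column); removing it, $i_{k-1}$ is the number of boxes in the largest hook of the remaining diagram, and so on recursively. -}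

module Defs where

open import Level using (0ℓ)
open import Data.Nat as ℕ using (ℕ; zero; suc; _+_; _≤_; _<_; ⌊_/2⌋; ⌈_/2⌉; pred; _≤?_)
open import Data.Fin as Fin using (Fin; toℕ)
open import Data.Vec using (Vec; lookup)
open import Data.List using (List; []; _∷_; _++_; length; map; filter)
open import Data.Nat.ListAction using (sum)
open import Data.List.Relation.Unary.All using (All)
open import Data.List.Relation.Unary.Linked using (Linked)
open import Data.List.Membership.Propositional using (_∈_)
open import Data.Product using (Σ; _×_; proj₁)
open import Function.Bundles using (_⇔_)
open import Relation.Nullary using (¬_)
open import Relation.Binary.Bundles using (Setoid)
open import Relation.Binary.PropositionalEquality using (_≡_; refl; sym; trans)

SubSetoid : (A : Set) → (A → Set) → Setoid 0ℓ 0ℓ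
SubSetoid A P = record
  { Carrier = Σ A P
  ; _≈_ = λ x y → proj₁ x ≡ proj₁ y
  ; isEquivalence = record { refl = refl ; sym = sym ; trans = trans }
  }

-- Permutations of {1,…,n}, stored 0-indexed as the vector (π(1),…,π(n)).

Perm : ℕ → Set
Perm n = Vec (Fin n) n

-- π is an involution (hence in particular a permutation).
IsInvolution : ∀ {n} → Perm n → Set
IsInvolution {n} π = (i : Fin n) → lookup π (lookup π i) ≡ i

Avoids321 : ∀ {n} → Perm n → Set
Avoids321 {n} π = (i j k : Fin n) → i Fin.< j → j Fin.< k →
  ¬ (lookup π k Fin.< lookup π j × lookup π j Fin.< lookup π i)

-- p (1-indexed, 1 ≤ p ≤ n-1) is a descent: π(p) > π(p+1).
-- With 0-indexed positions, i = p-1 and j = p.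
IsDescent : ∀ {n} → Perm n → ℕ → Set
IsDescent {n} π p = Σ (Fin n) λ i → Σ (Fin n) λ j →
  (suc (toℕ i) ≡ p) × (toℕ j ≡ p) × (lookup π j Fin.< lookup π i)

DesEquals : ∀ {n} → Perm n → List ℕ → Set
DesEquals π S = (p : ℕ) → (p ∈ S) ⇔ IsDescent π p

DesClass : ℕ → List ℕ → Setoid 0ℓ 0ℓ
DesClass n S = SubSetoid (Perm n) λ π →
  IsInvolution π × Avoids321 π × DesEquals π S

IsPartition : List ℕ → Set
IsPartition λ' = Linked (λ a b → b ≤ a) λ' × All (λ a → 1 ≤ a) λ'

FitsBox : ℕ → List ℕ → Set
FitsBox n λ' = length λ' ≤ ⌊ n /2⌋ × All (λ a → a ≤ ⌈ n /2⌉) λ'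

removeHook : List ℕ → List ℕ
removeHook [] = []
removeHook (a ∷ rest) = filter (1 ≤?_) (map pred rest)

-- Hook decomposition, listed increasingly (i_1 < … < i_k); the fuel
-- (number of parts) suffices since each step removes at least one part.
hdFuel : ℕ → List ℕ → List ℕ
hdFuel zero _ = []
hdFuel (suc f) [] = []
hdFuel (suc f) (a ∷ rest) = hdFuel f (removeHook (a ∷ rest)) ++ ((a + length rest) ∷ [])

hd : List ℕ → List ℕ
hd λ' = hdFuel (length λ') λ'

HdClass : ℕ → ℕ → List ℕ → Setoid 0ℓ 0ℓ
HdClass n m S = SubSetoid (List ℕ) λ λ' →
  IsPartition λ' × (sum λ' ≡ m) × (hd λ' ≡ S) × FitsBox n λ'

{-# OPTIONS --safe #-}
module Submission where

-- Record a 321-avoiding involution by a word of excedances, deficiencies and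
-- fixed points. Avoidance forces the excedances to be matched with the
-- deficiencies first come, first served, and allows a fixed point only when no
-- excedance is pending, so the word (a Motzkin path whose flat steps lie at
-- height 0) determines the involution, and its descents are the factors
-- "excedance, deficiency".
--
-- Write X for an excedance and Y for a deficiency; of the r fixed points write
-- the first ⌊r/2⌋ as Y and the others as X. Only excedances and deficiencies
-- occur in the factors XY, so these still mark the descents. Matching every X
-- with a later Y, as for parentheses, recovers the fixed points as the unmatched
-- letters, and every word with ⌈n/2⌉ letters X and ⌊n/2⌋ letters Y arises.
--
-- Finally read a factor XY that splits the word after a letters X and c letters Y
-- as a hook with a boxes in its row and c further boxes in its column. The hook
-- has a + c boxes, which is the position of the factor, and a and c increase
-- strictly from one factor to the next, so the hooks nest to a partition in the
-- box; every partition in the box arises once, by peeling off its outer hooks.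

open import Defs
open import Data.Nat using (ℕ; _≤_; _<_)
open import Data.List using (List)
open import Data.Nat.ListAction using (sum)
open import Data.List.Relation.Unary.All using (All)
open import Data.List.Relation.Unary.Linked using (Linked)
open import Data.Product using (_×_)
open import Function.Bundles using (Bijection)
open import Data.Empty using (⊥-elim)
open import Data.Fin using (Fin; toℕ; fromℕ<)
open import Data.Fin.Properties using (toℕ-fromℕ<; toℕ-injective; toℕ<n; fromℕ<-toℕ)
open import Data.List using ([]; _∷_; _++_; [_]; length; map; filter; replicate)
open import Data.List.Properties using (length-map; length-replicate; length-++; ++-identityʳ; length-filter; ∷-injective)
open import Data.List.Membership.Propositional using (_∈_)
open import Data.List.Membership.Propositional.Properties using (∈-++⁺ˡ; ∈-++⁺ʳ; ∈-++⁻)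
open import Data.List.Relation.Unary.All as All using ([]; _∷_)
import Data.List.Relation.Unary.All.Properties as All
open import Data.List.Relation.Unary.AllPairs using (AllPairs; []; _∷_)
import Data.List.Relation.Unary.AllPairs.Properties as AllPairs
open import Data.List.Relation.Unary.Any using (here; there)
open import Data.List.Relation.Unary.Linked as Linked using ([]; [-]; _∷_)
open import Data.List.Relation.Unary.Linked.Properties using (Linked⇒All; Linked⇒AllPairs)
open import Data.Nat using (zero; suc; pred; _+_; _∸_; _≥_; _≤?_; _<?_; _≟_; z≤n; s≤s; s≤s⁻¹; ⌊_/2⌋; ⌈_/2⌉)
open import Data.Nat.Induction using (<-rec)
open import Data.Nat.ListAction.Properties using (sum-++)
open import Data.Nat.Properties
open import Data.Product using (Σ; ∃; ∃₂; _,_; proj₁; proj₂)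
open import Data.Sum using (_⊎_; inj₁; inj₂)
open import Data.Vec using (lookup; tabulate)
open import Data.Vec.Properties using (lookup∘tabulate; tabulate∘lookup; tabulate-cong)
open import Function using (_∘_)
open import Function.Bundles using (_⇔_; mk⇔; Equivalence)
open import Relation.Binary.Definitions using (tri<; tri≈; tri>)
open import Relation.Binary.PropositionalEquality using (_≡_; _≢_; refl; sym; trans; cong; cong₂; subst; subst₂; module ≡-Reasoning)
open import Relation.Nullary using (¬_; yes; no; contradiction)

-- Partitions in a box as words

-- Words and paths are stored with their last letter at the head of the list.

data Letter : Set where
  X Y : Letter

#X #Y : List Letter → ℕ
#X []      = 0
#X (X ∷ w) = suc (#X w)
#X (Y ∷ w) = #X w
#Y []      = 0
#Y (X ∷ w) = #Y w
#Y (Y ∷ w) = suc (#Y w)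

length-#X+#Y : ∀ w → length w ≡ #X w + #Y w
length-#X+#Y []      = refl
length-#X+#Y (X ∷ w) = cong suc (length-#X+#Y w)
length-#X+#Y (Y ∷ w) = trans (cong suc (length-#X+#Y w)) (sym (+-suc (#X w) (#Y w)))

addHook : ℕ → ℕ → List ℕ → List ℕ
addHook a c μ = a ∷ (map suc μ ++ replicate (c ∸ length μ) 1)

-- A head Y before an X is a factor XY of the word; its hook is the outermost one,
-- since the factors further down the list come earlier in the word.
shape : List Letter → List ℕ
shape []          = []
shape (X ∷ w)     = shape w
shape (Y ∷ [])    = []
shape (Y ∷ Y ∷ w) = shape (Y ∷ w)
shape (Y ∷ X ∷ w) = addHook (suc (#X w)) (#Y w) (shape w)

-- Prepending `x` to the chain bounds the largest part and covers the empty partition too; in an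
-- induction on the rows, each row then serves as the bound for the next.
record InBox (x y : ℕ) (μ : List ℕ) : Set where
  constructor inBox
  field
    linked   : Linked _≥_ (x ∷ μ)
    positive : All (1 ≤_) μ
    short    : length μ ≤ y

open InBox

length-addHook : ∀ a c μ → length μ ≤ c → length (addHook a c μ) ≡ suc c
length-addHook a c μ l≤c = cong suc (begin
  length (map suc μ ++ replicate (c ∸ length μ) 1)          ≡⟨ length-++ (map suc μ) ⟩
  length (map suc μ) + length (replicate (c ∸ length μ) 1)  ≡⟨ cong₂ _+_ (length-map suc μ) (length-replicate (c ∸ length μ)) ⟩
  length μ + (c ∸ length μ)                                 ≡⟨ m+[n∸m]≡n l≤c ⟩
  c ∎)
  where open ≡-Reasoning

linked-raise : ∀ {a b μ} → a ≤ b → Linked _≥_ (a ∷ μ) → Linked _≥_ (b ∷ μ)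
linked-raise a≤b [-]      = [-]
linked-raise a≤b (p ∷ ps) = ≤-trans p a≤b ∷ ps

linked-addColumn : ∀ {a μ} k → Linked _≥_ (a ∷ μ) → Linked _≥_ (suc a ∷ (map suc μ ++ replicate k 1))
linked-addColumn zero    [-]      = [-]
linked-addColumn (suc k) [-]      = s≤s z≤n ∷ linked-addColumn k [-]
linked-addColumn k       (p ∷ ps) = s≤s p ∷ linked-addColumn k ps

positive-addColumn : ∀ μ k → All (1 ≤_) (map suc μ ++ replicate k 1)
positive-addColumn []      zero    = []
positive-addColumn []      (suc k) = s≤s z≤n ∷ positive-addColumn [] k
positive-addColumn (m ∷ μ) k       = s≤s z≤n ∷ positive-addColumn μ k

-- After a factor XY the new hook has as many boxes in its row as there are letters X so far, and as
-- many in its column as there are letters Y, so it touches both sides of the box. Any other letter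
-- only enlarges the box.
shape-inBox : ∀ w → InBox (#X w) (#Y w) (shape w)
shape-inBox []          = inBox [-] [] z≤n
shape-inBox (X ∷ w)     = let inBox l p s = shape-inBox w in inBox (linked-raise (n≤1+n _) l) p s
shape-inBox (Y ∷ [])    = inBox [-] [] z≤n
shape-inBox (Y ∷ Y ∷ w) = let inBox l p s = shape-inBox (Y ∷ w) in inBox l p (m≤n⇒m≤1+n s)
shape-inBox (Y ∷ X ∷ w) = let inBox l p s = shape-inBox w in
  inBox (≤-refl ∷ linked-addColumn (#Y w ∸ length (shape w)) l)
        (s≤s z≤n ∷ positive-addColumn (shape w) (#Y w ∸ length (shape w)))
        (≤-reflexive (length-addHook (suc (#X w)) (#Y w) (shape w) s))

-- Lowering the rows by one turns the ones of the first column into zeros, which the filter drops;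
-- positivity saves the rows of `μ`.
removeHook-addHook : ∀ a c μ → All (1 ≤_) μ → removeHook (addHook a c μ) ≡ μ
removeHook-addHook a c μ pos = go μ (c ∸ length μ) pos
  where
  go : ∀ μ k → All (1 ≤_) μ → filter (1 ≤?_) (map pred (map suc μ ++ replicate k 1)) ≡ μ
  go []          zero    []       = refl
  go []          (suc k) []       = go [] k []
  go (suc m ∷ μ) k       (_ ∷ ps) = cong (suc m ∷_) (go μ k ps)

linked-1⇒replicate : ∀ {μ} → Linked _≥_ (1 ∷ μ) → All (1 ≤_) μ → μ ≡ replicate (length μ) 1
linked-1⇒replicate [-] [] = refl
linked-1⇒replicate (s≤s z≤n ∷ l) (s≤s z≤n ∷ p) = cong (1 ∷_) (linked-1⇒replicate l p)

-- In a decreasing chain of positive parts only ones follow the first one. So the rows longer than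
-- one, shortened, make up `μ`, and the ones are the rest of the column.
removeColumn : ∀ {a} ν → Linked _≥_ (suc a ∷ ν) → All (1 ≤_) ν →
  ∃ λ μ → InBox a (length ν) μ × ν ≡ map suc μ ++ replicate (length ν ∸ length μ) 1
removeColumn [] l p = [] , inBox [-] [] z≤n , refl
removeColumn (suc zero ∷ ν) (q ∷ l) (_ ∷ p) =
  [] , inBox [-] [] z≤n , cong (1 ∷_) (linked-1⇒replicate l p)
removeColumn (suc (suc b) ∷ ν) (s≤s q ∷ l) (_ ∷ p) with removeColumn ν l p
... | μ , inBox l′ p′ s , eq = suc b ∷ μ , inBox (q ∷ l′) (s≤s z≤n ∷ p′) (s≤s s) , cong (suc (suc b) ∷_) eq

shape-replicate-Y : ∀ y → shape (replicate y Y) ≡ []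
shape-replicate-Y zero          = refl
shape-replicate-Y (suc zero)    = refl
shape-replicate-Y (suc (suc y)) = shape-replicate-Y (suc y)

#X-replicate-Y : ∀ y → #X (replicate y Y) ≡ 0
#X-replicate-Y zero    = refl
#X-replicate-Y (suc y) = #X-replicate-Y y

#Y-replicate-Y : ∀ y → #Y (replicate y Y) ≡ y
#Y-replicate-Y zero    = refl
#Y-replicate-Y (suc y) = cong suc (#Y-replicate-Y y)

-- In a box of positive width the last letters are read off from the sides that the partition
-- touches: X if the first row is too short, YY if the row is full but the column is not, XY if both
-- are full.
shape-surjective : ∀ x y μ → InBox x y μ → ∃ λ w → #X w ≡ x × #Y w ≡ y × shape w ≡ μ
shape-surjective zero y [] b =
  replicate y Y , #X-replicate-Y y , #Y-replicate-Y y , shape-replicate-Y y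
shape-surjective zero y (a ∷ μ) (inBox (a≤0 ∷ _) (1≤a ∷ _) _) = contradiction (≤-trans 1≤a a≤0) λ ()
shape-surjective (suc x) y [] b with shape-surjective x y [] (inBox [-] [] z≤n)
... | w , ex , ey , es = X ∷ w , cong suc ex , ey , es
shape-surjective (suc x) y (a ∷ ν) (inBox (a≤1+x ∷ l) p s) with m≤n⇒m<n∨m≡n a≤1+x
... | inj₁ (s≤s a≤x) with shape-surjective x y (a ∷ ν) (inBox (a≤x ∷ l) p s)
...   | w , ex , ey , es = X ∷ w , cong suc ex , ey , es
shape-surjective (suc x) (suc y) (a ∷ ν) (inBox (a≤1+x ∷ l) p (s≤s s)) | inj₂ refl with m≤n⇒m<n∨m≡n s
... | inj₁ s< with shape-surjective (suc x) y (suc x ∷ ν) (inBox (a≤1+x ∷ l) p s<)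
...   | Y ∷ w , ex , ey , es = Y ∷ Y ∷ w , ex , cong suc ey , es
-- A last letter X would confine the shape to width `x`, but its first row is `suc x`.
...   | X ∷ w , refl , ey , es =
        contradiction (Linked.head (subst (λ ν → Linked _≥_ (x ∷ ν)) es (linked (shape-inBox w)))) (<⇒≱ ≤-refl)
shape-surjective (suc x) (suc y) (a ∷ ν) (inBox (a≤1+x ∷ l) (_ ∷ p) (s≤s s)) | inj₂ refl | inj₂ len
  with removeColumn ν l p
... | μ , b , eq with shape-surjective x y μ (subst (λ y → InBox x y μ) len b)
...   | w , refl , ey , refl = Y ∷ X ∷ w , refl , cong suc ey ,
          cong (suc x ∷_) (trans (cong (λ c → map suc (shape w) ++ replicate (c ∸ length (shape w)) 1)
                                       (trans ey (sym len)))
                                 (sym eq))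

-- Before the final run of letters Y stands the last X of the word; the hook of this factor XY has
-- all the letters X in its row.
shape-Y-head : ∀ w {x} → #X w ≡ suc x → ∃ λ ν → shape (Y ∷ w) ≡ suc x ∷ ν
shape-Y-head (X ∷ w) refl = _ , refl
shape-Y-head (Y ∷ w) eq   = shape-Y-head w eq

shape-X≢shape-Y : ∀ w v → #X (X ∷ w) ≡ #X v → shape w ≢ shape (Y ∷ v)
shape-X≢shape-Y w v ex es with shape-Y-head v (sym ex)
... | ν , eq = contradiction
  (Linked.head (subst (λ μ → Linked _≥_ (#X w ∷ μ)) (trans es eq) (linked (shape-inBox w)))) (<⇒≱ ≤-refl)

-- An ending XY fills every row of the box. The competing word is `Y ∷ Y ∷ v`, whose shape is that
-- of `Y ∷ v` and so leaves a row empty.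
shape-peak≢shape-Y : ∀ w v → #Y w ≡ suc (#Y v) → shape (Y ∷ X ∷ w) ≢ shape (Y ∷ v)
shape-peak≢shape-Y w v ey es = contradiction
  (begin
    suc (suc (#Y v))             ≡⟨ cong suc ey ⟨
    suc (#Y w)                   ≡⟨ length-addHook (suc (#X w)) (#Y w) (shape w) (short (shape-inBox w)) ⟨
    length (shape (Y ∷ X ∷ w))   ≡⟨ cong length es ⟩
    length (shape (Y ∷ v))       ≤⟨ short (shape-inBox (Y ∷ v)) ⟩
    suc (#Y v)                   ∎)
  (<⇒≱ ≤-refl)
  where open ≤-Reasoning

shape-injective : ∀ w v → #X w ≡ #X v → #Y w ≡ #Y v → shape w ≡ shape v → w ≡ v
shape-injective []      []      ex ey es = refl
shape-injective []      (X ∷ v) () ey es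
shape-injective []      (Y ∷ v) ex () es
shape-injective (X ∷ w) []      () ey es
shape-injective (Y ∷ w) []      ex () es
shape-injective (X ∷ w) (X ∷ v) ex ey es = cong (X ∷_) (shape-injective w v (suc-injective ex) ey es)
shape-injective (X ∷ w) (Y ∷ v) ex ey es = contradiction es (shape-X≢shape-Y w v ex)
shape-injective (Y ∷ w) (X ∷ v) ex ey es = contradiction (sym es) (shape-X≢shape-Y v w (sym ex))
shape-injective (Y ∷ [])    (Y ∷ [])    ex ey es = refl
shape-injective (Y ∷ [])    (Y ∷ X ∷ v) () ey es
shape-injective (Y ∷ X ∷ w) (Y ∷ [])    () ey es
shape-injective (Y ∷ [])    (Y ∷ Y ∷ v) ex () es
shape-injective (Y ∷ Y ∷ w) (Y ∷ [])    ex () es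
shape-injective (Y ∷ Y ∷ w) (Y ∷ Y ∷ v) ex ey es =
  cong (Y ∷_) (shape-injective (Y ∷ w) (Y ∷ v) ex (suc-injective ey) es)
shape-injective (Y ∷ X ∷ w) (Y ∷ Y ∷ v) ex ey es = contradiction es (shape-peak≢shape-Y w v (suc-injective ey))
shape-injective (Y ∷ Y ∷ w) (Y ∷ X ∷ v) ex ey es =
  contradiction (sym es) (shape-peak≢shape-Y v w (sym (suc-injective ey)))
shape-injective (Y ∷ X ∷ w) (Y ∷ X ∷ v) ex ey es =
  cong (λ u → Y ∷ X ∷ u) (shape-injective w v (suc-injective ex) (suc-injective ey) (begin
    shape w                                              ≡⟨ removeHook-addHook (suc (#X w)) (#Y w) (shape w) (positive (shape-inBox w)) ⟨
    removeHook (addHook (suc (#X w)) (#Y w) (shape w))   ≡⟨ cong removeHook es ⟩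
    removeHook (addHook (suc (#X v)) (#Y v) (shape v))   ≡⟨ removeHook-addHook (suc (#X v)) (#Y v) (shape v) (positive (shape-inBox v)) ⟩
    shape v                                              ∎))
  where open ≡-Reasoning

-- Peaks of a word and hook lengths

peakAfter : List Letter → List ℕ
peakAfter []      = []
peakAfter (X ∷ w) = [ suc (length w) ]
peakAfter (Y ∷ w) = []

peaks : List Letter → List ℕ
peaks []      = []
peaks (X ∷ w) = peaks w
peaks (Y ∷ w) = peaks w ++ peakAfter w

length-removeHook : ∀ a μ → length (removeHook (a ∷ μ)) ≤ length μ
length-removeHook a μ = ≤-trans (length-filter (1 ≤?_) (map pred μ)) (≤-reflexive (length-map pred μ))

-- Once the outer hook of `addHook a c μ` is removed, the fuel left for `μ` is `c`, while `hd μ`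
-- starts from `length μ`. Both suffice, as every step removes at least one part.
hdFuel-irrelevant : ∀ f g μ → length μ ≤ f → length μ ≤ g → hdFuel f μ ≡ hdFuel g μ
hdFuel-irrelevant zero    zero    []      _ _ = refl
hdFuel-irrelevant zero    (suc g) []      _ _ = refl
hdFuel-irrelevant (suc f) zero    []      _ _ = refl
hdFuel-irrelevant (suc f) (suc g) []      _ _ = refl
hdFuel-irrelevant (suc f) (suc g) (a ∷ μ) (s≤s p) (s≤s q) = cong (_++ [ a + length μ ])
  (hdFuel-irrelevant f g (removeHook (a ∷ μ))
    (≤-trans (length-removeHook a μ) p) (≤-trans (length-removeHook a μ) q))

hd-addHook : ∀ a c μ → length μ ≤ c → All (1 ≤_) μ → hd (addHook a c μ) ≡ hd μ ++ [ a + c ]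
hd-addHook a c μ l≤c pos = cong₂ (λ S k → S ++ [ a + k ])
  (trans (cong (hdFuel (length ν)) (removeHook-addHook a c μ pos))
         (hdFuel-irrelevant (length ν) (length μ) μ (≤-trans l≤c (≤-reflexive (sym len))) ≤-refl))
  len
  where
  ν = map suc μ ++ replicate (c ∸ length μ) 1
  len : length ν ≡ c
  len = suc-injective (length-addHook a c μ l≤c)

-- The hook of a factor XY has one box for each letter up to and including that X, so its length is
-- the position of the factor.
hd-shape : ∀ w → hd (shape w) ≡ peaks w
hd-shape []          = refl
hd-shape (X ∷ w)     = hd-shape w
hd-shape (Y ∷ [])    = refl
hd-shape (Y ∷ Y ∷ w) = trans (hd-shape (Y ∷ w)) (sym (++-identityʳ _))
hd-shape (Y ∷ X ∷ w) = trans (hd-addHook _ (#Y w) (shape w) s p)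
  (cong₂ (λ ν k → ν ++ [ suc k ]) (hd-shape w) (sym (length-#X+#Y w)))
  where open InBox (shape-inBox w) renaming (short to s; positive to p; linked to l)

sum-addHook : ∀ a c μ → length μ ≤ c → sum (addHook a c μ) ≡ sum μ + (a + c)
sum-addHook a c μ l≤c = begin
  a + sum (map suc μ ++ replicate (c ∸ length μ) 1)  ≡⟨ cong (a +_) (go μ (c ∸ length μ)) ⟩
  a + (sum μ + (length μ + (c ∸ length μ)))          ≡⟨ cong (λ k → a + (sum μ + k)) (m+[n∸m]≡n l≤c) ⟩
  a + (sum μ + c)                                    ≡⟨ +-assoc a (sum μ) c ⟨
  a + sum μ + c                                      ≡⟨ cong (_+ c) (+-comm a (sum μ)) ⟩
  sum μ + a + c                                      ≡⟨ +-assoc (sum μ) a c ⟩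
  sum μ + (a + c)                                    ∎
  where
  open ≡-Reasoning
  go : ∀ μ k → sum (map suc μ ++ replicate k 1) ≡ sum μ + (length μ + k)
  go []      zero    = refl
  go []      (suc k) = cong suc (go [] k)
  go (m ∷ μ) k       = begin
    suc (m + sum (map suc μ ++ replicate k 1))  ≡⟨ cong (λ s → suc (m + s)) (go μ k) ⟩
    suc (m + (sum μ + (length μ + k)))          ≡⟨ cong suc (+-assoc m (sum μ) _) ⟨
    suc (m + sum μ + (length μ + k))            ≡⟨ +-suc (m + sum μ) _ ⟨
    m + sum μ + suc (length μ + k)              ∎

sum-shape : ∀ w → sum (shape w) ≡ sum (peaks w)
sum-shape []          = refl
sum-shape (X ∷ w)     = sum-shape w
sum-shape (Y ∷ [])    = refl
sum-shape (Y ∷ Y ∷ w) = trans (sum-shape (Y ∷ w)) (cong sum (sym (++-identityʳ (peaks (Y ∷ w)))))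
sum-shape (Y ∷ X ∷ w) = begin
  sum (addHook (suc (#X w)) (#Y w) (shape w))  ≡⟨ sum-addHook _ (#Y w) (shape w) (short (shape-inBox w)) ⟩
  sum (shape w) + suc (#X w + #Y w)            ≡⟨ cong₂ (λ s k → s + suc k) (sum-shape w) (sym (length-#X+#Y w)) ⟩
  sum (peaks w) + suc (length w)               ≡⟨ cong (sum (peaks w) +_) (+-identityʳ _) ⟨
  sum (peaks w) + sum [ suc (length w) ]       ≡⟨ sum-++ (peaks w) _ ⟨
  sum (peaks w ++ [ suc (length w) ])          ∎
  where open ≡-Reasoning

-- Colourings of Motzkin paths

data Kind : Set where
  exc def fix : Kind

private variable
  h h′ p p′ r r′ : ℕ
  t t′ : List Kind
  w w′ : List Letter

-- The index is the final height, the number of excedances that still wait for a deficiency.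
data Path : ℕ → List Kind → Set where
  []  : Path 0 []
  exc : Path h t → Path (suc h) (exc ∷ t)
  def : Path (suc h) t → Path h (def ∷ t)
  fix : Path 0 t → Path 0 (fix ∷ t)

-- Colouring p r h t w: w replaces the flat steps of t by p letters Y, all of them
-- before r letters X (fixY requires that no X has been used yet).
data Colouring : ℕ → ℕ → ℕ → List Kind → List Letter → Set where
  []   : Colouring 0 0 0 [] []
  exc  : Colouring p r h t w → Colouring p r (suc h) (exc ∷ t) (X ∷ w)
  def  : Colouring p r (suc h) t w → Colouring p r h (def ∷ t) (Y ∷ w)
  fixY : Colouring p 0 0 t w → Colouring (suc p) 0 0 (fix ∷ t) (Y ∷ w)
  fixX : Colouring p r 0 t w → Colouring p (suc r) 0 (fix ∷ t) (X ∷ w)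

hit : Kind → Kind → ℕ
hit exc exc = 1
hit def def = 1
hit fix fix = 1
hit _   _   = 0

count : Kind → List Kind → ℕ
count k []      = 0
count k (l ∷ t) = hit k l + count k t

count-exc-def : Path h t → count exc t ≡ h + count def t
count-exc-def []      = refl
count-exc-def (exc c) = cong suc (count-exc-def c)
count-exc-def {h} (def {t = t} c) = trans (count-exc-def c) (sym (+-suc h (count def t)))
count-exc-def (fix c) = count-exc-def c

colour : Path h t → ∀ p r → p + r ≡ count fix t → ∃ λ w → Colouring p r h t w
colour []      zero    zero    eq = [] , []
colour (exc c) p       r       eq with colour c p r eq
... | w , d = X ∷ w , exc d
colour (def c) p       r       eq with colour c p r eq
... | w , d = Y ∷ w , def d
-- The path is consumed from its end, so flat steps receive X until `r` runs out and Y from then on.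
colour (fix c) (suc p) zero    eq with colour c p 0 (suc-injective eq)
... | w , d = Y ∷ w , fixY d
colour (fix c) p       (suc r) eq with colour c p r (suc-injective (trans (sym (+-suc p r)) eq))
... | w , d = X ∷ w , fixX d

colouring⇒path : Colouring p r h t w → Path h t
colouring⇒path []       = []
colouring⇒path (exc c)  = exc (colouring⇒path c)
colouring⇒path (def c)  = def (colouring⇒path c)
colouring⇒path (fixY c) = fix (colouring⇒path c)
colouring⇒path (fixX c) = fix (colouring⇒path c)

colouring-count-fix : Colouring p r h t w → p + r ≡ count fix t
colouring-count-fix []       = refl
colouring-count-fix (exc c)  = colouring-count-fix c
colouring-count-fix (def c)  = colouring-count-fix c
colouring-count-fix (fixY c) = cong suc (colouring-count-fix c)
colouring-count-fix {p = p} (fixX {r = r} c) = trans (+-suc p r) (cong suc (colouring-count-fix c))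

colouring-#X : Colouring p r h t w → #X w ≡ count exc t + r
colouring-#X []       = refl
colouring-#X (exc c)  = cong suc (colouring-#X c)
colouring-#X (def c)  = colouring-#X c
colouring-#X (fixY c) = colouring-#X c
colouring-#X (fixX {r = r} {t = t} c) = trans (cong suc (colouring-#X c)) (sym (+-suc (count exc t) r))

colouring-#Y : Colouring p r h t w → #Y w ≡ count def t + p
colouring-#Y []       = refl
colouring-#Y (exc c)  = colouring-#Y c
colouring-#Y (def c)  = cong suc (colouring-#Y c)
colouring-#Y (fixY {p = p} {t = t} c) = trans (cong suc (colouring-#Y c)) (sym (+-suc (count def t) p))
colouring-#Y (fixX c) = colouring-#Y c

colouring-length : Colouring p r h t w → length w ≡ length t
colouring-length []       = refl
colouring-length (exc c)  = cong suc (colouring-length c)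
colouring-length (def c)  = cong suc (colouring-length c)
colouring-length (fixY c) = cong suc (colouring-length c)
colouring-length (fixX c) = cong suc (colouring-length c)

colouring-functional : Colouring p r h t w → Colouring p r h′ t w′ → w ≡ w′
colouring-functional []       []       = refl
colouring-functional (exc c)  (exc d)  = cong (X ∷_) (colouring-functional c d)
colouring-functional (def c)  (def d)  = cong (Y ∷_) (colouring-functional c d)
colouring-functional (fixY c) (fixY d) = cong (Y ∷_) (colouring-functional c d)
colouring-functional (fixX c) (fixX d) = cong (X ∷_) (colouring-functional c d)

-- A colouring without flat X reaches the greatest height; this rules out reading a
-- letter Y as a flat step in one colouring and as a descending step in another.
colouring-highest : Colouring p 0 h t w → Colouring p′ r′ h′ t′ w → h′ ≤ h
colouring-highest []       []       = z≤n
colouring-highest (exc c)  (exc d)  = s≤s (colouring-highest c d)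
colouring-highest (exc c)  (fixX d) = z≤n
colouring-highest (def c)  (def d)  = s≤s⁻¹ (colouring-highest c d)
colouring-highest (def c)  (fixY d) = z≤n
colouring-highest (fixY c) (def d)  = contradiction (colouring-highest c d) λ ()
colouring-highest (fixY c) (fixY d) = z≤n

-- The height tells an ascending X from a flat one. Just before a flat Y there is no flat X yet and
-- the height is 0, so by `colouring-highest` no colouring of that part ends higher; just before a
-- descending Y the height is positive.
colouring-injective : Colouring p r h t w → Colouring p′ r′ h t′ w → t ≡ t′
colouring-injective []       []       = refl
colouring-injective (exc c)  (exc d)  = cong (exc ∷_) (colouring-injective c d)
colouring-injective (def c)  (def d)  = cong (def ∷_) (colouring-injective c d)
colouring-injective (def c)  (fixY d) = contradiction (colouring-highest d c) λ ()
colouring-injective (fixY c) (def d)  = contradiction (colouring-highest c d) λ ()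
colouring-injective (fixY c) (fixY d) = cong (fix ∷_) (colouring-injective c d)
colouring-injective (fixX c) (fixX d) = cong (fix ∷_) (colouring-injective c d)

-- Read first every X as an ascending step; lowering the final height then turns
-- the X that stay unmatched into flat steps.
decolour-high : ∀ w → ∃₂ λ h p → ∃ λ t → Colouring p 0 h t w
decolour-high []      = 0 , 0 , [] , []
decolour-high (X ∷ w) with decolour-high w
... | h , p , t , c = suc h , p , exc ∷ t , exc c
decolour-high (Y ∷ w) with decolour-high w
... | zero  , p , t , c = 0 , suc p , fix ∷ t , fixY c
... | suc h , p , t , c = h , p , def ∷ t , def c

colouring-lower : Colouring p 0 h t w → h′ ≤ h → ∃₂ λ r t′ → Colouring p r h′ t′ w
colouring-lower []       z≤n     = _ , _ , []
-- To end at height 0, this X must become a flat step, and the part before it must come down to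
-- height 0 too.
colouring-lower (exc c)  z≤n     with colouring-lower c z≤n
... | r , t , d = _ , _ , fixX d
colouring-lower (exc c)  (s≤s q) with colouring-lower c q
... | r , t , d = _ , _ , exc d
colouring-lower (def c)  q       with colouring-lower c (s≤s q)
... | r , t , d = _ , _ , def d
colouring-lower (fixY c) z≤n     = _ , _ , fixY c

decolour : ∀ w → ∃₂ λ p r → ∃ λ t → Colouring p r 0 t w
decolour w with decolour-high w
... | h , p , t , c with colouring-lower c z≤n
...   | r , t′ , d = p , r , t′ , d

turnAfter : List Kind → List ℕ
turnAfter []        = []
turnAfter (exc ∷ t) = [ suc (length t) ]
turnAfter (def ∷ t) = []
turnAfter (fix ∷ t) = []

turns : List Kind → List ℕ
turns []        = []
turns (exc ∷ t) = turns t
turns (def ∷ t) = turns t ++ turnAfter t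
turns (fix ∷ t) = turns t

-- Flat steps take part in no factor XY: an X right before a descending step ends at positive height
-- and hence ascends, while a flat Y starts at height 0 with no flat X before it, so no X precedes
-- it directly.
peaks≡turns : Colouring p r h t w → peaks w ≡ turns t
peaks≡turns []       = refl
peaks≡turns (exc c)  = peaks≡turns c
peaks≡turns (fixX c) = peaks≡turns c
peaks≡turns (def c)  = cong₂ _++_ (peaks≡turns c) (after c)
  where
  after : Colouring p r (suc h) t w → peakAfter w ≡ turnAfter t
  after (exc c) = cong (λ l → [ suc l ]) (colouring-length c)
  after (def c) = refl
peaks≡turns (fixY {w = w} c) = trans (trans (cong (peaks w ++_) (after c)) (++-identityʳ _)) (peaks≡turns c)
  where
  after : Colouring p 0 0 t w → peakAfter w ≡ []
  after []       = refl
  after (def c)  = refl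
  after (fixY c) = refl

-- A way to say that `y` and `x` are the two halves of their sum that survives adding the same
-- number to both or cancelling it, as happens with the matched pairs of letters.
Balanced : ℕ → ℕ → Set
Balanced y x = y ≡ x ⊎ suc y ≡ x

balanced-halves : ∀ n → Balanced ⌊ n /2⌋ ⌈ n /2⌉
balanced-halves zero          = inj₁ refl
balanced-halves (suc zero)    = inj₂ refl
balanced-halves (suc (suc n)) with balanced-halves n
... | inj₁ eq = inj₁ (cong suc eq)
... | inj₂ eq = inj₂ (cong suc eq)

balanced⇒halves : ∀ {y x} → Balanced y x → y ≡ ⌊ y + x /2⌋ × x ≡ ⌈ y + x /2⌉
balanced⇒halves {y} (inj₁ refl) = n≡⌊n+n/2⌋ y , n≡⌈n+n/2⌉ y
balanced⇒halves {y} (inj₂ refl) rewrite +-suc y y = n≡⌈n+n/2⌉ y , cong suc (n≡⌊n+n/2⌋ y)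

balanced-+ : ∀ k {y x} → Balanced y x → Balanced (k + y) (k + x)
balanced-+ k (inj₁ refl) = inj₁ refl
balanced-+ k {y} (inj₂ refl) = inj₂ (sym (+-suc k y))

balanced-cancel-+ : ∀ k {y x} → Balanced (k + y) (k + x) → Balanced y x
balanced-cancel-+ k (inj₁ eq) = inj₁ (+-cancelˡ-≡ k _ _ eq)
balanced-cancel-+ k {y} (inj₂ eq) = inj₂ (+-cancelˡ-≡ k _ _ (trans (+-suc k y) eq))

-- Sequences of kinds and their turns

prefix : (ℕ → Kind) → ℕ → List Kind
prefix τ zero    = []
prefix τ (suc n) = τ n ∷ prefix τ n

length-prefix : ∀ τ n → length (prefix τ n) ≡ n
length-prefix τ zero    = refl
length-prefix τ (suc n) = cong suc (length-prefix τ n)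

prefix-cong : ∀ {τ σ} n → (∀ {i} → i < n → τ i ≡ σ i) → prefix τ n ≡ prefix σ n
prefix-cong zero    eq = refl
prefix-cong (suc n) eq = cong₂ _∷_ (eq (n<1+n n)) (prefix-cong n (eq ∘ m<n⇒m<1+n))

prefix-injective : ∀ {τ σ} n → prefix τ n ≡ prefix σ n → ∀ {i} → i < n → τ i ≡ σ i
prefix-injective (suc n) eq i<1+n with ∷-injective eq | m<1+n⇒m<n∨m≡n i<1+n
... | _  , eqs | inj₁ i<n  = prefix-injective n eqs i<n
... | eq , _   | inj₂ refl = eq

at : List Kind → ℕ → Kind
at []      i = fix
at (k ∷ t) i with i ≟ length t
... | yes _ = k
... | no  _ = at t i

prefix-at : ∀ t → prefix (at t) (length t) ≡ t
prefix-at []      = refl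
prefix-at (k ∷ t) = cong₂ _∷_ last (trans (prefix-cong (length t) below) (prefix-at t))
  where
  last : at (k ∷ t) (length t) ≡ k
  last with length t ≟ length t
  ... | yes _ = refl
  ... | no ¬p = contradiction refl ¬p
  below : ∀ {i} → i < length t → at (k ∷ t) i ≡ at t i
  below {i} i<l with i ≟ length t
  ... | yes refl = contradiction i<l (<-irrefl refl)
  ... | no _     = refl

TurnAt : (ℕ → Kind) → ℕ → ℕ → Set
TurnAt τ n q = ∃ λ i → q ≡ suc i × suc i < n × τ i ≡ exc × τ (suc i) ≡ def

∈-turnAfter⁺ : ∀ τ i → τ i ≡ exc → suc i ∈ turnAfter (prefix τ (suc i))
∈-turnAfter⁺ τ i eq rewrite eq = here (cong suc (sym (length-prefix τ i)))

∈-turnAfter⁻ : ∀ τ n {q} → q ∈ turnAfter (prefix τ n) → ∃ λ i → q ≡ suc i × suc i ≡ n × τ i ≡ exc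
∈-turnAfter⁻ τ (suc n) q∈ with τ n in eq
∈-turnAfter⁻ τ (suc n) (here refl) | exc = n , cong suc (length-prefix τ n) , refl , eq

∈-turns⁺ : ∀ τ n {q} → TurnAt τ n q → q ∈ turns (prefix τ n)
∈-turns⁺ τ (suc n) (i , refl , i<n , e , d) with τ n in eq | m<1+n⇒m<n∨m≡n i<n
... | exc | inj₁ i<n  = ∈-turns⁺ τ n (i , refl , i<n , e , d)
... | fix | inj₁ i<n  = ∈-turns⁺ τ n (i , refl , i<n , e , d)
... | def | inj₁ i<n  = ∈-++⁺ˡ (∈-turns⁺ τ n (i , refl , i<n , e , d))
... | def | inj₂ refl = ∈-++⁺ʳ (turns (prefix τ n)) (∈-turnAfter⁺ τ i e)
... | exc | inj₂ refl = contradiction (trans (sym eq) d) λ ()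
... | fix | inj₂ refl = contradiction (trans (sym eq) d) λ ()

∈-turns⁻ : ∀ τ n {q} → q ∈ turns (prefix τ n) → TurnAt τ n q
∈-turns⁻ τ (suc n) q∈ with τ n in eq
∈-turns⁻ τ (suc n) q∈ | exc = let i , q≡ , i<n , rest = ∈-turns⁻ τ n q∈ in i , q≡ , m<n⇒m<1+n i<n , rest
∈-turns⁻ τ (suc n) q∈ | fix = let i , q≡ , i<n , rest = ∈-turns⁻ τ n q∈ in i , q≡ , m<n⇒m<1+n i<n , rest
∈-turns⁻ τ (suc n) q∈ | def with ∈-++⁻ (turns (prefix τ n)) q∈
... | inj₁ q∈₁ = let i , q≡ , i<n , rest = ∈-turns⁻ τ n q∈₁ in i , q≡ , m<n⇒m<1+n i<n , rest
... | inj₂ q∈₂ with ∈-turnAfter⁻ τ n q∈₂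
...   | i , refl , refl , e = i , refl , n<1+n (suc i) , e , eq

-- 321-avoiding involutions as Motzkin paths

record Involution321 (n : ℕ) (f : ℕ → ℕ) : Set where
  field
    bounded    : ∀ {i} → i < n → f i < n
    involutive : ∀ {i} → i < n → f (f i) ≡ i
    avoiding   : ∀ {i j k} → i < j → j < k → k < n → f k < f j → ¬ f j < f i

data HasKind (a i : ℕ) : Kind → Set where
  exc : i < a → HasKind a i exc
  def : a < i → HasKind a i def
  fix : a ≡ i → HasKind a i fix

hasKind : ∀ a i → ∃ (HasKind a i)
hasKind a i with <-cmp a i
... | tri< a<i _ _ = def , def a<i
... | tri≈ _ a≡i _ = fix , fix a≡i
... | tri> _ _ i<a = exc , exc i<a

hasKind-functional : ∀ {a i k l} → HasKind a i k → HasKind a i l → k ≡ l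
hasKind-functional (exc _) (exc _)    = refl
hasKind-functional (def _) (def _)    = refl
hasKind-functional (fix _) (fix _)    = refl
hasKind-functional (exc p) (def q)    = contradiction q (<-asym p)
hasKind-functional (def p) (exc q)    = contradiction q (<-asym p)
hasKind-functional (exc p) (fix refl) = contradiction p (<-irrefl refl)
hasKind-functional (def p) (fix refl) = contradiction p (<-irrefl refl)
hasKind-functional (fix refl) (exc q) = contradiction q (<-irrefl refl)
hasKind-functional (fix refl) (def q) = contradiction q (<-irrefl refl)

HasKinds : ℕ → (ℕ → ℕ) → (ℕ → Kind) → Set
HasKinds n f τ = ∀ {i} → i < n → HasKind (f i) i (τ i)

-- The number of e < k with f e ≥ i; for k = i this is the height of the path.
pending : (ℕ → ℕ) → ℕ → ℕ → ℕ
pending f zero    i = 0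
pending f (suc k) i with i ≤? f k
... | yes _ = suc (pending f k i)
... | no  _ = pending f k i

pending-skip : ∀ f k i → (∀ {e} → e < k → f e ≢ i) → pending f k i ≡ pending f k (suc i)
pending-skip f zero    i f≢i = refl
pending-skip f (suc k) i f≢i with i ≤? f k | suc i ≤? f k
... | yes i≤ | yes _  = cong suc (pending-skip f k i (f≢i ∘ m<n⇒m<1+n))
... | no _   | no _   = pending-skip f k i (f≢i ∘ m<n⇒m<1+n)
... | yes i≤ | no i≮  = contradiction (≤-antisym (≮⇒≥ i≮) i≤) (f≢i (n<1+n k))
... | no i≰  | yes i< = contradiction (<⇒≤ i<) i≰

pending-drop : ∀ f k i {e} → e < k → f e ≡ i → (∀ {e′} → e′ < k → f e′ ≡ i → e′ ≡ e) →
  pending f k i ≡ suc (pending f k (suc i))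
pending-drop f (suc k) i e<k fe≡i unique with m<1+n⇒m<n∨m≡n e<k
... | inj₂ refl with i ≤? f k | suc i ≤? f k
...   | yes _ | no _   = cong suc (pending-skip f k i λ e<k fe≡i → <⇒≢ e<k (unique (m<n⇒m<1+n e<k) fe≡i))
...   | no i≰ | _      = contradiction (≤-reflexive (sym fe≡i)) i≰
...   | yes _ | yes i< = contradiction (sym fe≡i) (<⇒≢ i<)
pending-drop f (suc k) i e<k fe≡i unique | inj₁ e<k′ with i ≤? f k | suc i ≤? f k
...   | yes _  | yes _  = cong suc (pending-drop f k i e<k′ fe≡i (unique ∘ m<n⇒m<1+n))
...   | no _   | no _   = pending-drop f k i e<k′ fe≡i (unique ∘ m<n⇒m<1+n)
...   | yes i≤ | no i≮  = contradiction (sym (unique (n<1+n k) (≤-antisym (≮⇒≥ i≮) i≤))) (<⇒≢ e<k′)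
...   | no i≰  | yes i< = contradiction (<⇒≤ i<) i≰

pending-none : ∀ f k i → (∀ {e} → e < k → f e < i) → pending f k i ≡ 0
pending-none f zero    i f< = refl
pending-none f (suc k) i f< with i ≤? f k
... | yes i≤ = contradiction (f< (n<1+n k)) (≤⇒≯ i≤)
... | no _   = pending-none f k i (f< ∘ m<n⇒m<1+n)

pending-suc : ∀ f k i → i ≤ f k → pending f (suc k) i ≡ suc (pending f k i)
pending-suc f k i i≤ with i ≤? f k
... | yes _ = refl
... | no i≰ = contradiction i≤ i≰

pending-same : ∀ f k i → f k < i → pending f (suc k) i ≡ pending f k i
pending-same f k i f< with i ≤? f k
... | yes i≤ = contradiction f< (≤⇒≯ i≤)
... | no _   = refl

module _ {n f} (inv : Involution321 n f) where
  open Involution321 inv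

  f-swap : ∀ {i j} → i < n → f i ≡ j → f j ≡ i
  f-swap i<n refl = involutive i<n

  -- An excedance at `m` becomes pending, and no earlier position has value `m`; a deficiency
  -- releases the one earlier position with value `m`, namely `f m`; at a fixed point nothing is
  -- pending, by `below`.
  involution⇒prefixPath : ∀ {τ} → HasKinds n f τ → ∀ m → m ≤ n → Path (pending f m m) (prefix τ m)
  involution⇒prefixPath         kinds zero    m≤n = []
  involution⇒prefixPath {τ = τ} kinds (suc m) m<n with τ m | kinds m<n | involution⇒prefixPath kinds m (<⇒≤ m<n)
  ... | .exc | exc m<fm | c = subst (λ h → Path h (exc ∷ prefix τ m))
        (sym (trans (pending-suc f m (suc m) m<fm)
                    (cong suc (sym (pending-skip f m m λ e<m fe≡m →
                      <-asym e<m (subst (m <_) (f-swap (<-trans e<m m<n) fe≡m) m<fm))))))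
        (exc c)
  ... | .def | def fm<m | c = subst (λ h → Path h (def ∷ prefix τ m))
        (sym (pending-same f m (suc m) (m<n⇒m<1+n fm<m)))
        (def (subst (λ h → Path h (prefix τ m))
          (pending-drop f m m fm<m (involutive m<n) λ e<m fe≡m → sym (f-swap (<-trans e<m m<n) fe≡m)) c))
  ... | .fix | fix fm≡m | c = subst (λ h → Path h (fix ∷ prefix τ m))
        (sym (trans (pending-same f m (suc m) (s≤s (≤-reflexive fm≡m)))
                    (pending-none f m (suc m) (m<n⇒m<1+n ∘ below))))
        (fix (subst (λ h → Path h (prefix τ m)) (pending-none f m m below) c))
    where
    below : ∀ {e} → e < m → f e < m
    below {e} e<m with <-cmp (f e) m
    ... | tri< fe<m _ _ = fe<m
    ... | tri≈ _ fe≡m _ = contradiction (trans (sym (f-swap (<-trans e<m m<n) fe≡m)) fm≡m) (<⇒≢ e<m)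
    -- The positions `e < m < f e` carry the values `f e > m > e`, a 321 pattern.
    ... | tri> _ _ m<fe = ⊥-elim (avoiding e<m m<fe (bounded e<n)
            (subst₂ _<_ (sym (involutive e<n)) (sym fm≡m) e<m) (subst (_< f e) (sym fm≡m) m<fe))
      where e<n = <-trans e<m m<n

  involution⇒path : ∀ {τ} → HasKinds n f τ → Path 0 (prefix τ n)
  involution⇒path {τ} kinds = subst (λ h → Path h (prefix τ n)) (pending-none f n n bounded)
    (involution⇒prefixPath kinds n ≤-refl)

  -- If `f i ≤ i`, the positions `f (suc i)`, `i`, `suc i` carry the values `suc i`, `f i`,
  -- `f (suc i)`, a 321 pattern; if `suc i ≤ f (suc i)`, the positions `i`, `suc i`, `f i` form one.
  descent⇒turn : ∀ {τ i} → HasKinds n f τ → suc i < n → f (suc i) < f i → τ i ≡ exc × τ (suc i) ≡ def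
  descent⇒turn {i = i} kinds i<n des =
    hasKind-functional (kinds (<⇒≤ i<n)) (exc (≰⇒> λ fi≤i →
      avoiding (<-≤-trans des fi≤i) (n<1+n i) i<n des
        (subst (f i <_) (sym (involutive i<n)) (s≤s fi≤i)))) ,
    hasKind-functional (kinds i<n) (def (≰⇒> λ i<fi+1 →
      avoiding (n<1+n i) (≤-<-trans i<fi+1 des) (bounded (<⇒≤ i<n))
        (subst (_< f (suc i)) (sym (involutive (<⇒≤ i<n))) i<fi+1) des))

  turn⇒descent : ∀ {τ i} → HasKinds n f τ → suc i < n → τ i ≡ exc → τ (suc i) ≡ def → f (suc i) < f i
  turn⇒descent {τ} {i} kinds i<n e d with τ i | kinds (<⇒≤ i<n) | τ (suc i) | kinds i<n
  ... | exc | exc i<fi | def | def fi+1<i+1 = <-≤-trans fi+1<i+1 i<fi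

-- Induction over positions: a deficiency has its partner at an earlier position, where `f` and `g`
-- agree already; for excedances a first disagreement is refuted by `clash`.
kinds-determine : ∀ {n f g τ} → Involution321 n f → Involution321 n g → HasKinds n f τ → HasKinds n g τ →
  ∀ {i} → i < n → f i ≡ g i
kinds-determine {n} {f} {g} {τ} invf invg kf kg {i} = <-rec (λ i → i < n → f i ≡ g i) step i
  where
  -- If f i < g i at the first disagreement, let e = g (f i). Then e > i, and the
  -- positions i < e < g i carry the values g i > f i > i of g.
  clash : ∀ {f g} → Involution321 n f → Involution321 n g → HasKinds n f τ → HasKinds n g τ →
    ∀ {i} → (∀ {j} → j < i → f j ≡ g j) → i < n → i < f i → ¬ f i < g i
  clash {f} {g} invf invg kf kg {i} agree i<n i<fi fi<gi = go (kf fi<n) (kg fi<n)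
    where
    module F = Involution321 invf
    module G = Involution321 invg
    fi<n = F.bounded i<n
    gg = G.involutive fi<n
    -- Since `f (f i) = i < f i`, the position `f i` is a deficiency of `f`, hence also of `g`,
    -- which gives `e < f i`.
    go : ∀ {k} → HasKind (f (f i)) (f i) k → ¬ HasKind (g (f i)) (f i) k
    go (exc q) _ = <-asym i<fi (subst (f i <_) (F.involutive i<n) q)
    go (fix q) _ = <⇒≢ i<fi (trans (sym (F.involutive i<n)) q)
    go (def _) (def e<fi) with <-cmp (g (f i)) i
    ... | tri< e<i _ _ = <⇒≢ e<i
            (trans (sym (f-swap invf (<-trans e<i i<n) (trans (agree e<i) gg))) (F.involutive i<n))
    ... | tri≈ _ e≡i _ = <⇒≢ fi<gi (sym (f-swap invg fi<n e≡i))
    ... | tri> _ _ i<e = G.avoiding i<e (<-trans e<fi fi<gi) (G.bounded i<n)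
            (subst₂ _<_ (sym (G.involutive i<n)) (sym gg) i<fi) (subst (_< g i) (sym gg) fi<gi)
  step : ∀ i → (∀ {j} → j < i → j < n → f j ≡ g j) → i < n → f i ≡ g i
  step i rec i<n with τ i | kf i<n | kg i<n
  ... | .fix | fix p | fix q = trans p (sym q)
  ... | .def | def p | def q =
          sym (f-swap invg fi<n (trans (sym (rec p fi<n)) (Involution321.involutive invf i<n)))
    where fi<n = Involution321.bounded invf i<n
  ... | .exc | exc p | exc q with <-cmp (f i) (g i)
  ...   | tri≈ _ eq _ = eq
  ...   | tri< fi<gi _ _ = ⊥-elim (clash invf invg kf kg (λ j<i → rec j<i (<-trans j<i i<n)) i<n p fi<gi)
  ...   | tri> _ _ gi<fi = ⊥-elim (clash invg invf kg kf (λ j<i → sym (rec j<i (<-trans j<i i<n))) i<n q gi<fi)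

-- Reconstruction of the involution from a path

hit-view : ∀ k l → hit k l ≡ 0 ⊎ (l ≡ k × hit k l ≡ 1)
hit-view exc exc = inj₂ (refl , refl)
hit-view exc def = inj₁ refl
hit-view exc fix = inj₁ refl
hit-view def exc = inj₁ refl
hit-view def def = inj₂ (refl , refl)
hit-view def fix = inj₁ refl
hit-view fix exc = inj₁ refl
hit-view fix def = inj₁ refl
hit-view fix fix = inj₂ (refl , refl)

hit-refl : ∀ k → hit k k ≡ 1
hit-refl exc = refl
hit-refl def = refl
hit-refl fix = refl

path-prefix : ∀ τ {n h} → Path h (prefix τ n) → ∀ {i} → i ≤ n → ∃ λ h → Path h (prefix τ i)
path-prefix τ {n} c i≤n with m≤n⇒m<n∨m≡n i≤n
... | inj₂ refl = _ , c
path-prefix τ {suc n} c i≤n | inj₁ (s≤s i≤n′) with τ n | c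
... | exc | exc c′ = path-prefix τ c′ i≤n′
... | def | def c′ = path-prefix τ c′ i≤n′
... | fix | fix c′ = path-prefix τ c′ i≤n′

module Reconstruction (τ : ℕ → Kind) (n : ℕ) (path : Path 0 (prefix τ n)) where

  -- For a position of kind `k` this is its rank among the positions of that kind, counted from 0.
  # : Kind → ℕ → ℕ
  # k i = count k (prefix τ i)

  #-mono : ∀ k {i j} → i ≤ j → # k i ≤ # k j
  #-mono k {i} {j} i≤j with m≤n⇒m<n∨m≡n i≤j
  ... | inj₂ refl = ≤-refl
  #-mono k {i} {suc j} i≤j | inj₁ (s≤s i≤j′) = ≤-trans (#-mono k i≤j′) (m≤n+m _ (hit k (τ j)))

  #-suc : ∀ {k i} → τ i ≡ k → # k (suc i) ≡ suc (# k i)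
  #-suc {k} {i} refl = cong (_+ # k i) (hit-refl (τ i))

  #-strict : ∀ {k i j} → τ i ≡ k → i < j → # k i < # k j
  #-strict {k} τi i<j = ≤-trans (≤-reflexive (sym (#-suc τi))) (#-mono k i<j)

  #-injective : ∀ {k i j} → τ i ≡ k → τ j ≡ k → # k i ≡ # k j → i ≡ j
  #-injective {k} {i} {j} τi τj eq with <-cmp i j
  ... | tri< i<j _ _ = contradiction eq (<⇒≢ (#-strict τi i<j))
  ... | tri≈ _ i≡j _ = i≡j
  ... | tri> _ _ j<i = contradiction (sym eq) (<⇒≢ (#-strict τj j<i))

  #-attains : ∀ k m c → c < # k m → ∃ λ j → j < m × τ j ≡ k × # k j ≡ c
  #-attains k (suc m) c c< with hit-view k (τ m)
  ... | inj₁ eq rewrite eq = let j , j<m , rest = #-attains k m c c< in j , m<n⇒m<1+n j<m , rest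
  ... | inj₂ (τm , eq) rewrite eq with m<1+n⇒m<n∨m≡n c<
  ...   | inj₁ c<′ = let j , j<m , rest = #-attains k m c c<′ in j , m<n⇒m<1+n j<m , rest
  ...   | inj₂ refl = m , n<1+n m , τm , refl

  #def≤#exc : ∀ {i} → i ≤ n → # def i ≤ # exc i
  #def≤#exc i≤n = let h , c = path-prefix τ path i≤n in
    ≤-trans (m≤n+m _ h) (≤-reflexive (sym (count-exc-def c)))

  #exc≡#def-fix : ∀ {i} → i < n → τ i ≡ fix → # exc i ≡ # def i
  #exc≡#def-fix {i} i<n τi with τ i | path-prefix τ path i<n
  #exc≡#def-fix {i} i<n refl | .fix | _ , fix c = count-exc-def c

  -- If `j` came first, more deficiencies than excedances would precede `i`.
  exc-before-def : ∀ {i j} → i ≤ n → τ i ≡ exc → τ j ≡ def → # exc i ≡ # def j → i < j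
  exc-before-def {i} {j} i≤n τi τj eq with <-cmp i j
  ... | tri< i<j _ _  = i<j
  ... | tri≈ _ refl _ = contradiction (trans (sym τi) τj) λ ()
  ... | tri> _ _ j<i  = contradiction
    (≤-trans (#-strict τj j<i) (≤-trans (#def≤#exc i≤n) (≤-reflexive eq))) (<-irrefl refl)

  -- An excedance and a deficiency of equal rank are matched, which is the rule first come, first
  -- served.
  data Match : ℕ → ℕ → Set where
    exc : ∀ {i j} → i < j → τ i ≡ exc → τ j ≡ def → # exc i ≡ # def j → Match i j
    def : ∀ {i j} → j < i → τ i ≡ def → τ j ≡ exc → # exc j ≡ # def i → Match i j
    fix : ∀ {i} → τ i ≡ fix → Match i i

  match-sym : ∀ {i j} → Match i j → Match j i
  match-sym (exc i<j τi τj eq) = def i<j τj τi eq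
  match-sym (def j<i τi τj eq) = exc j<i τj τi eq
  match-sym (fix τi)           = fix τi

  match-functional : ∀ {i j k} → Match i j → Match i k → j ≡ k
  match-functional (exc _ _ τj e) (exc _ _ τk e′) = #-injective τj τk (trans (sym e) e′)
  match-functional (def _ _ τj e) (def _ _ τk e′) = #-injective τj τk (trans e (sym e′))
  match-functional (fix _) (fix _) = refl
  match-functional (exc _ τi _ _) (def _ τi′ _ _) = contradiction (trans (sym τi) τi′) λ ()
  match-functional (exc _ τi _ _) (fix τi′)       = contradiction (trans (sym τi) τi′) λ ()
  match-functional (def _ τi _ _) (exc _ τi′ _ _) = contradiction (trans (sym τi) τi′) λ ()
  match-functional (def _ τi _ _) (fix τi′)       = contradiction (trans (sym τi) τi′) λ ()
  match-functional (fix τi) (exc _ τi′ _ _)       = contradiction (trans (sym τi) τi′) λ ()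
  match-functional (fix τi) (def _ τi′ _ _)       = contradiction (trans (sym τi) τi′) λ ()

  partner : ∀ {i} → i < n → ∃ λ j → j < n × Match i j
  partner {i} i<n with τ i in τi
  ... | fix = i , i<n , fix τi
  ... | exc = let j , j<n , τj , eq = #-attains def n (# exc i)
                    -- The path ends at height 0, so there are as many deficiencies as excedances,
                    -- and one of them has the rank of `i`.
                    (subst (# exc i <_) (count-exc-def path) (#-strict τi i<n))
              in j , j<n , exc (exc-before-def (<⇒≤ i<n) τi τj (sym eq)) τi τj (sym eq)
  ... | def = let j , j<n , τj , eq = #-attains exc n (# def i)
                    (subst (# def i <_) (sym (count-exc-def path)) (#-strict τi i<n))
              in j , j<n , def (exc-before-def (<⇒≤ j<n) τj τi eq) τi τj eq

  f : ℕ → ℕ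
  f i with i <? n
  ... | yes i<n = proj₁ (partner i<n)
  ... | no  _   = i

  f-match : ∀ {i} → i < n → f i < n × Match i (f i)
  f-match {i} i<n with i <? n
  ... | yes i<n′ = proj₂ (partner i<n′)
  ... | no i≮n   = contradiction i<n i≮n

  -- With `a` the partner of `i`, the number of excedances before a later `j` exceeds the number of
  -- deficiencies before `a`; so neither a pair nor a fixed point lies inside the pair of `i` and
  -- `a`.
  no-nesting : ∀ {i j} a → τ i ≡ exc → # exc i ≡ # def a → i < j → ¬ # exc j ≤ # def a
  no-nesting a τi eq i<j le = contradiction
    (<-≤-trans (#-strict τi i<j) (≤-trans le (≤-reflexive (sym eq)))) (<-irrefl refl)

  match-exc : ∀ {i a} → Match i a → i < a → τ i ≡ exc × # exc i ≡ # def a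
  match-exc (exc _ τi _ eq) i<a = τi , eq
  match-exc (def a<i _ _ _) i<a = contradiction a<i (<-asym i<a)
  match-exc (fix _)         i<a = contradiction i<a (<-irrefl refl)

  f-avoiding : ∀ {i j k} → i < j → j < k → k < n → f k < f j → ¬ f j < f i
  f-avoiding {i} {j} {k} i<j j<k k<n fk<fj fj<fi = go fk<fj fj<fi (proj₂ (f-match j<n))
    where
    j<n = <-trans j<k k<n
    mi = proj₂ (f-match (<-trans i<j j<n))
    mk = proj₂ (f-match k<n)
    -- `b` is `f j`, kept general so that its match with `j` can be analysed. An excedance or fixed
    -- point `j` would lie inside the pair of `i`; a deficiency `j` would have its pair inside that
    -- of `k`.
    go : ∀ {b} → f k < b → b < f i → ¬ Match j b
    go fk<b b<fi (exc j<b _ _ eq) = let τi , eqi = match-exc mi (<-trans i<j (<-trans j<b b<fi)) in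
      no-nesting (f i) τi eqi i<j (≤-trans (≤-reflexive eq) (#-mono def (<⇒≤ b<fi)))
    go fk<b b<fi (fix τj) = let τi , eqi = match-exc mi (<-trans i<j b<fi) in
      no-nesting (f i) τi eqi i<j (≤-trans (≤-reflexive (#exc≡#def-fix j<n τj)) (#-mono def (<⇒≤ b<fi)))
    go fk<b b<fi (def b<j _ _ eq) =
      let τfk , eqk = match-exc (match-sym mk) (<-trans fk<b (<-trans b<j j<k)) in
      no-nesting k τfk eqk fk<b (≤-trans (≤-reflexive eq) (#-mono def (<⇒≤ j<k)))

  involution : Involution321 n f
  involution = record
    { bounded    = proj₁ ∘ f-match
    ; involutive = λ i<n → let fi<n , m = f-match i<n in
        match-functional (proj₂ (f-match fi<n)) (match-sym m)
    ; avoiding   = f-avoiding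
    }

  match⇒hasKind : ∀ {i j} → Match i j → HasKind j i (τ i)
  match⇒hasKind (exc i<j τi _ _) = subst (HasKind _ _) (sym τi) (exc i<j)
  match⇒hasKind (def j<i τi _ _) = subst (HasKind _ _) (sym τi) (def j<i)
  match⇒hasKind (fix τi)         = subst (HasKind _ _) (sym τi) (fix refl)

  hasKinds : HasKinds n f τ
  hasKinds i<n = match⇒hasKind (proj₂ (f-match i<n))

-- The correspondence

-- With a relation, the proofs never unfold the map chosen by `total`; functionality makes that map
-- respect equality, which ignores the proof components.
relation⇒bijection : ∀ {A B : Set} {P : A → Set} {Q : B → Set} (R : A → B → Set) →
  (∀ {a} → P a → ∃ λ b → Q b × R a b) →
  (∀ {b} → Q b → ∃ λ a → P a × R a b) →
  (∀ {a b b′} → R a b → R a b′ → b ≡ b′) →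
  (∀ {a a′ b} → R a b → R a′ b → a ≡ a′) →
  Bijection (SubSetoid A P) (SubSetoid B Q)
relation⇒bijection {P = P} {Q} R total surj functional injective = record
  { to        = λ (_ , Pa) → proj₁ (total Pa) , proj₁ (proj₂ (total Pa))
  ; cong      = λ {x} {y} → unique {x} {y}
  ; bijective = (λ {x} {y} eq → injective (related (proj₂ x)) (subst (R (proj₁ y)) (sym eq) (related (proj₂ y))))
              , λ (_ , Qb) → let a , Pa , Rab = surj Qb in
                (a , Pa) , λ { {_ , Pa′} refl → functional (related Pa′) Rab }
  }
  where
  related : ∀ {a} (Pa : P a) → R a (proj₁ (total Pa))
  related Pa = proj₂ (proj₂ (total Pa))
  unique : ∀ {x y : Σ _ P} → proj₁ x ≡ proj₁ y → proj₁ (total (proj₂ x)) ≡ proj₁ (total (proj₂ y))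
  unique {_ , Pa} {_ , Pa′} refl = functional (related Pa) (related Pa′)

-- The head of a strictly increasing list is its least member and is absent from the tail, so the
-- heads agree and the equivalence passes to the tails.
sorted-ext : ∀ {xs ys} → AllPairs _<_ xs → AllPairs _<_ ys → (∀ z → z ∈ xs ⇔ z ∈ ys) → xs ≡ ys
sorted-ext {[]}     {[]}     _ _ eq = refl
sorted-ext {[]}     {y ∷ ys} _ _ eq = contradiction (Equivalence.from (eq y) (here refl)) λ ()
sorted-ext {x ∷ xs} {[]}     _ _ eq = contradiction (Equivalence.to (eq x) (here refl)) λ ()
sorted-ext {x ∷ xs} {y ∷ ys} (x< ∷ sx) (y< ∷ sy) eq = cong₂ _∷_ x≡y (sorted-ext sx sy λ z →
  mk⇔ (λ z∈ → tail (<⇒≢ (subst (_< z) x≡y (All.lookup x< z∈))) (Equivalence.to (eq z) (there z∈)))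
      (λ z∈ → tail (<⇒≢ (subst (_< z) (sym x≡y) (All.lookup y< z∈))) (Equivalence.from (eq z) (there z∈))))
  where
  least : ∀ {u us z} → All (u <_) us → z ∈ u ∷ us → u ≤ z
  least u< (here refl) = ≤-refl
  least u< (there z∈)  = <⇒≤ (All.lookup u< z∈)
  x≡y : x ≡ y
  x≡y = ≤-antisym (least x< (Equivalence.from (eq y) (here refl))) (least y< (Equivalence.to (eq x) (here refl)))
  tail : ∀ {u us z} → u ≢ z → z ∈ u ∷ us → z ∈ us
  tail u≢z (here refl) = contradiction refl u≢z
  tail u≢z (there z∈)  = z∈

peaks-bounded : ∀ w → All (_< length w) (peaks w)
peaks-bounded []          = []
peaks-bounded (X ∷ w)     = All.map m<n⇒m<1+n (peaks-bounded w)
peaks-bounded (Y ∷ w)     = All.++⁺ (All.map m<n⇒m<1+n (peaks-bounded w)) (after w)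
  where
  after : ∀ w → All (_< suc (length w)) (peakAfter w)
  after []      = []
  after (X ∷ w) = n<1+n _ ∷ []
  after (Y ∷ w) = []

peaks-sorted : ∀ w → AllPairs _<_ (peaks w)
peaks-sorted []      = []
peaks-sorted (X ∷ w) = peaks-sorted w
peaks-sorted (Y ∷ w) = AllPairs.++⁺ (peaks-sorted w) (single w) (All.map (below w) (peaks-bounded w))
  where
  single : ∀ w → AllPairs _<_ (peakAfter w)
  single []      = []
  single (X ∷ w) = [] ∷ []
  single (Y ∷ w) = []
  below : ∀ w {q} → q < length w → All (q <_) (peakAfter w)
  below (X ∷ w) q< = q< ∷ []
  below (Y ∷ w) q< = []

-- Permutations as functions on the naturals

record Represents {n} (f : ℕ → ℕ) (π : Perm n) : Set where
  constructor represented
  field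
    value : ∀ i → f (toℕ i) ≡ toℕ (lookup π i)

open Represents

extend : ∀ {n} → Perm n → ℕ → ℕ
extend {n} π i with i <? n
... | yes i<n = toℕ (lookup π (fromℕ< i<n))
... | no  _   = i

extend-represents : ∀ {n} (π : Perm n) → Represents (extend π) π
extend-represents {n} π = represented go
  where
  go : ∀ i → extend π (toℕ i) ≡ toℕ (lookup π i)
  go i with toℕ i <? n
  ... | yes i<n = cong (toℕ ∘ lookup π) (fromℕ<-toℕ i i<n)
  ... | no i≮n  = contradiction (toℕ<n i) i≮n

restrict : ∀ {n} (f : ℕ → ℕ) → (∀ {i} → i < n → f i < n) → Perm n
restrict f bounded = tabulate λ i → fromℕ< (bounded (toℕ<n i))

restrict-represents : ∀ {n} (f : ℕ → ℕ) (bounded : ∀ {i} → i < n → f i < n) → Represents f (restrict f bounded)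
restrict-represents f bounded = represented λ i → sym
  (trans (cong toℕ (lookup∘tabulate (λ i → fromℕ< (bounded (toℕ<n i))) i)) (toℕ-fromℕ< (bounded (toℕ<n i))))

represents-ext : ∀ {n f g} {π σ : Perm n} → Represents f π → Represents g σ →
  (∀ {i} → i < n → f i ≡ g i) → π ≡ σ
represents-ext {π = π} {σ} rf rg eq = begin
  π                    ≡⟨ tabulate∘lookup π ⟨
  tabulate (lookup π)  ≡⟨ tabulate-cong (λ i → toℕ-injective (trans (sym (value rf i)) (trans (eq (toℕ<n i)) (value rg i)))) ⟩
  tabulate (lookup σ)  ≡⟨ tabulate∘lookup σ ⟩
  σ                    ∎
  where open ≡-Reasoning

asFin : ∀ {n i} → i < n → ∃ λ (j : Fin n) → toℕ j ≡ i
asFin i<n = fromℕ< i<n , toℕ-fromℕ< i<n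

module _ {n f} {π : Perm n} (rep : Represents f π) where

  represents-twice : ∀ i → f (f (toℕ i)) ≡ toℕ (lookup π (lookup π i))
  represents-twice i = trans (cong f (value rep i)) (value rep (lookup π i))

  represents⇒involution321 : IsInvolution π → Avoids321 π → Involution321 n f
  represents⇒involution321 inv avoid = record { bounded = bounded ; involutive = involutive ; avoiding = avoiding }
    where
    bounded : ∀ {i} → i < n → f i < n
    bounded i<n with asFin i<n
    ... | i , refl = subst (_< n) (sym (value rep i)) (toℕ<n (lookup π i))
    involutive : ∀ {i} → i < n → f (f i) ≡ i
    involutive i<n with asFin i<n
    ... | i , refl = trans (represents-twice i) (cong toℕ (inv i))
    avoiding : ∀ {i j k} → i < j → j < k → k < n → f k < f j → ¬ f j < f i
    avoiding i<j j<k k<n p q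
      with asFin (<-trans i<j (<-trans j<k k<n)) | asFin (<-trans j<k k<n) | asFin k<n
    ... | i , refl | j , refl | k , refl =
      avoid i j k i<j j<k (subst₂ _<_ (value rep k) (value rep j) p , subst₂ _<_ (value rep j) (value rep i) q)

  involution321⇒IsInvolution : Involution321 n f → IsInvolution π
  involution321⇒IsInvolution inv i = toℕ-injective
    (trans (sym (represents-twice i)) (Involution321.involutive inv (toℕ<n i)))

  involution321⇒Avoids321 : Involution321 n f → Avoids321 π
  involution321⇒Avoids321 inv i j k i<j j<k (p , q) = Involution321.avoiding inv i<j j<k (toℕ<n k)
    (subst₂ _<_ (sym (value rep k)) (sym (value rep j)) p) (subst₂ _<_ (sym (value rep j)) (sym (value rep i)) q)

  turn⇔descent : ∀ {τ} → Involution321 n f → HasKinds n f τ → ∀ q → TurnAt τ n q ⇔ IsDescent π q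
  turn⇔descent {τ} inv kinds q = mk⇔ to from
    where
    to : TurnAt τ n q → IsDescent π q
    to (i , refl , i<n , e , d) with asFin (<⇒≤ i<n) | asFin i<n
    ... | j , refl | k , eq = j , k , refl , eq , subst₂ _<_ (trans (cong f (sym eq)) (value rep k)) (value rep j)
      (turn⇒descent inv kinds i<n e d)
    from : IsDescent π q → TurnAt τ n q
    from (j , k , refl , eq , des) = toℕ j , refl , i<n ,
      descent⇒turn inv kinds i<n (subst₂ _<_ (trans (sym (value rep k)) (cong f eq)) (sym (value rep j)) des)
      where
      i<n = subst (_< n) eq (toℕ<n k)

inBox⇒partition : ∀ {x y μ} → InBox x y μ → IsPartition μ
inBox⇒partition (inBox l p _) = Linked.tail l , p

inBox⇒fits : ∀ {n μ} → InBox ⌈ n /2⌉ ⌊ n /2⌋ μ → FitsBox n μ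
inBox⇒fits (inBox l _ s) = s , All.tail (Linked⇒All (λ p q → ≤-trans q p) ≤-refl l)

fits⇒inBox : ∀ {n μ} → IsPartition μ → FitsBox n μ → InBox ⌈ n /2⌉ ⌊ n /2⌋ μ
fits⇒inBox {n} (l , p) (s , b) = inBox (cons l b) p s
  where
  cons : ∀ {μ} → Linked _≥_ μ → All (_≤ ⌈ n /2⌉) μ → Linked _≥_ (⌈ n /2⌉ ∷ μ)
  cons []      []      = [-]
  cons [-]     (q ∷ _) = q ∷ [-]
  cons (r ∷ l) (q ∷ _) = q ∷ r ∷ l

record Corresponds (n : ℕ) (π : Perm n) (μ : List ℕ) : Set where
  field
    {f}        : ℕ → ℕ
    {τ}        : ℕ → Kind
    {nY nX}    : ℕ
    {word}     : List Letter
    represents : Represents f π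
    involution : Involution321 n f
    kinds      : HasKinds n f τ
    colouring  : Colouring nY nX 0 (prefix τ n) word
    balanced   : Balanced nY nX
    shape≡     : shape word ≡ μ

  path : Path 0 (prefix τ n)
  path = colouring⇒path colouring

  nY+nX : nY + nX ≡ count fix (prefix τ n)
  nY+nX = colouring-count-fix colouring

  length-word : length word ≡ n
  length-word = trans (colouring-length colouring) (length-prefix τ n)

  #Y+#X : #Y word + #X word ≡ n
  #Y+#X = trans (+-comm (#Y word) (#X word)) (trans (sym (length-#X+#Y word)) length-word)

  balanced-word : Balanced (#Y word) (#X word)
  balanced-word = subst₂ Balanced (sym (colouring-#Y colouring))
    (sym (trans (colouring-#X colouring) (cong (_+ nX) (count-exc-def path))))
    (balanced-+ (count def (prefix τ n)) balanced)

  #Y-half : #Y word ≡ ⌊ n /2⌋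
  #Y-half = trans (proj₁ (balanced⇒halves balanced-word)) (cong ⌊_/2⌋ #Y+#X)

  #X-half : #X word ≡ ⌈ n /2⌉
  #X-half = trans (proj₂ (balanced⇒halves balanced-word)) (cong ⌈_/2⌉ #Y+#X)

  fits : InBox ⌈ n /2⌉ ⌊ n /2⌋ μ
  fits = subst (InBox _ _) shape≡ (subst₂ (λ x y → InBox x y (shape word)) #X-half #Y-half (shape-inBox word))

  hd≡peaks : hd μ ≡ peaks word
  hd≡peaks = trans (cong hd (sym shape≡)) (hd-shape word)

  sum≡sum-hd : sum μ ≡ sum (hd μ)
  sum≡sum-hd = trans (cong sum (sym shape≡)) (trans (sum-shape word) (cong sum (sym hd≡peaks)))

  hd-sorted : AllPairs _<_ (hd μ)
  hd-sorted = subst (AllPairs _<_) (sym hd≡peaks) (peaks-sorted word)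

  descents : DesEquals π (hd μ)
  descents q = mk⇔
    (Equivalence.to (turn⇔descent represents involution kinds q) ∘ ∈-turns⁻ τ n ∘ subst (q ∈_) hd≡turns)
    (subst (q ∈_) (sym hd≡turns) ∘ ∈-turns⁺ τ n ∘ Equivalence.from (turn⇔descent represents involution kinds q))
    where
    hd≡turns : hd μ ≡ turns (prefix τ n)
    hd≡turns = trans hd≡peaks (peaks≡turns colouring)

corresponds-total : ∀ {n} {π : Perm n} → IsInvolution π → Avoids321 π → ∃ (Corresponds n π)
corresponds-total {n} {π} inv avoid = shape (proj₁ coloured) , record
  { represents = rep
  ; involution = inv321
  ; kinds      = kinds
  ; colouring  = proj₂ coloured
  ; balanced   = balanced-halves m
  ; shape≡     = refl
  }
  where
  rep = extend-represents π
  inv321 = represents⇒involution321 rep inv avoid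
  τ : ℕ → Kind
  τ i = proj₁ (hasKind (extend π i) i)
  kinds : HasKinds n (extend π) τ
  kinds {i} _ = proj₂ (hasKind (extend π i) i)
  m = count fix (prefix τ n)
  coloured = colour (involution⇒path inv321 kinds) ⌊ m /2⌋ ⌈ m /2⌉ (⌊n/2⌋+⌈n/2⌉≡n m)

corresponds-surjective : ∀ {n μ} → InBox ⌈ n /2⌉ ⌊ n /2⌋ μ → ∃ λ (π : Perm n) → Corresponds n π μ
corresponds-surjective {n} box with shape-surjective _ _ _ box
... | w , #X≡ , #Y≡ , shape≡ with decolour w
...   | p , r , t , c = restrict f (Involution321.bounded involution) , record
  { represents = restrict-represents f (Involution321.bounded involution)
  ; involution = involution
  ; kinds      = hasKinds
  ; colouring  = c′
  ; balanced   = balanced-cancel-+ (count def t) (subst₂ Balanced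
      (trans (sym #Y≡) (colouring-#Y c))
      (trans (sym #X≡) (trans (colouring-#X c) (cong (_+ r) (count-exc-def (colouring⇒path c)))))
      (balanced-halves n))
  ; shape≡     = shape≡
  }
  where
  length-t : length t ≡ n
  length-t = begin
    length t               ≡⟨ colouring-length c ⟨
    length w               ≡⟨ length-#X+#Y w ⟩
    #X w + #Y w            ≡⟨ cong₂ _+_ #X≡ #Y≡ ⟩
    ⌈ n /2⌉ + ⌊ n /2⌋      ≡⟨ +-comm ⌈ n /2⌉ ⌊ n /2⌋ ⟩
    ⌊ n /2⌋ + ⌈ n /2⌉      ≡⟨ ⌊n/2⌋+⌈n/2⌉≡n n ⟩
    n                      ∎
    where open ≡-Reasoning
  c′ : Colouring p r 0 (prefix (at t) n) w
  c′ = subst (λ t → Colouring p r 0 t w)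
    (trans (sym (prefix-at t)) (cong (prefix (at t)) length-t)) c
  open Reconstruction (at t) n (colouring⇒path c′)

-- `π` determines the kinds and thus the number of fixed points, whose halves count the two colours;
-- so the word, and with it the shape, is unique.
corresponds-functional : ∀ {n π μ ν} → Corresponds n π μ → Corresponds n π ν → μ ≡ ν
corresponds-functional {n} {π} A B = begin
  _             ≡⟨ A.shape≡ ⟨
  shape A.word  ≡⟨ cong shape (colouring-functional A.colouring coloured) ⟩
  shape B.word  ≡⟨ B.shape≡ ⟩
  _             ∎
  where
  open ≡-Reasoning
  module A = Corresponds A
  module B = Corresponds B
  same-f : ∀ {i} → i < n → A.f i ≡ B.f i
  same-f i<n with asFin i<n
  ... | i , refl = trans (value A.represents i) (sym (value B.represents i))
  same-kinds : prefix A.τ n ≡ prefix B.τ n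
  same-kinds = prefix-cong n λ {i} i<n → hasKind-functional (A.kinds i<n)
    (subst (λ a → HasKind a i (B.τ i)) (sym (same-f i<n)) (B.kinds i<n))
  same-sum : B.nY + B.nX ≡ A.nY + A.nX
  same-sum = trans B.nY+nX (trans (cong (count fix) (sym same-kinds)) (sym A.nY+nX))
  nY≡ : B.nY ≡ A.nY
  nY≡ = trans (proj₁ (balanced⇒halves B.balanced)) (trans (cong ⌊_/2⌋ same-sum) (sym (proj₁ (balanced⇒halves A.balanced))))
  nX≡ : B.nX ≡ A.nX
  nX≡ = trans (proj₂ (balanced⇒halves B.balanced)) (trans (cong ⌈_/2⌉ same-sum) (sym (proj₂ (balanced⇒halves A.balanced))))
  coloured : Colouring A.nY A.nX 0 (prefix A.τ n) B.word
  coloured = subst (λ t → Colouring A.nY A.nX 0 t B.word) (sym same-kinds)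
    (subst₂ (λ y x → Colouring y x 0 (prefix B.τ n) B.word) nY≡ nX≡ B.colouring)

-- The chain is run backwards: the box prescribes the letter counts, so the shape determines the
-- word, the word the kinds, and the kinds the involution.
corresponds-injective : ∀ {n π σ μ} → Corresponds n π μ → Corresponds n σ μ → π ≡ σ
corresponds-injective {n} A B = represents-ext A.represents B.represents
  (kinds-determine A.involution B.involution A.kinds λ {i} i<n →
    subst (HasKind (B.f i) i) (sym (prefix-injective n same-kinds i<n)) (B.kinds i<n))
  where
  module A = Corresponds A
  module B = Corresponds B
  same-word : A.word ≡ B.word
  same-word = shape-injective A.word B.word (trans A.#X-half (sym B.#X-half)) (trans A.#Y-half (sym B.#Y-half))
    (trans A.shape≡ (sym B.shape≡))
  same-kinds : prefix A.τ n ≡ prefix B.τ n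
  same-kinds = colouring-injective A.colouring
    (subst (Colouring B.nY B.nX 0 (prefix B.τ n)) (sym same-word) B.colouring)

theorem3p4 : (n : ℕ) (is : List ℕ) → Linked _<_ is → All (λ i → 1 ≤ i × i < n) is →
    Bijection (DesClass n is) (HdClass n (sum is) is)
theorem3p4 n is sorted _ = relation⇒bijection (Corresponds n) total surjective
    corresponds-functional corresponds-injective
  where
  total : ∀ {π : Perm n} → IsInvolution π × Avoids321 π × DesEquals π is →
    ∃ λ μ → (IsPartition μ × sum μ ≡ sum is × hd μ ≡ is × FitsBox n μ) × Corresponds n π μ
  total (inv , avoid , des) with corresponds-total inv avoid
  ... | μ , C = μ , (inBox⇒partition fits , trans sum≡sum-hd (cong sum hd≡is) , hd≡is , inBox⇒fits fits) , C
    where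
    open Corresponds C
    hd≡is : hd μ ≡ is
    -- `DesEquals` compares members only; the lists are equal because both are strictly increasing.
    hd≡is = sorted-ext hd-sorted (Linked⇒AllPairs <-trans sorted) λ q →
      mk⇔ (Equivalence.from (des q) ∘ Equivalence.to (descents q))
          (Equivalence.from (descents q) ∘ Equivalence.to (des q))
  surjective : ∀ {μ} → IsPartition μ × sum μ ≡ sum is × hd μ ≡ is × FitsBox n μ →
    ∃ λ (π : Perm n) → (IsInvolution π × Avoids321 π × DesEquals π is) × Corresponds n π μ
  surjective {μ} (part , _ , hd≡is , fit) with corresponds-surjective (fits⇒inBox part fit)
  ... | π , C = π , (involution321⇒IsInvolution represents involution
                    , involution321⇒Avoids321 represents involution
                    , subst (DesEquals π) hd≡is descents) , C
    where open Corresponds C
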